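{- Consider the variety with no axioms in the language with a single unary function symbol $f$, and presentations with a single generator $a$ and a single identity $f^{(r)}(a)=f^{(r')}(a)$, $r,r'\ge 0$. Let $\mathcal{A}$ be the structure that is the disjoint union of (i) an $\omega$-chain and (ii) a component consisting of two $\omega^*$-chains and one $\omega$-chain that come together at a special point, this point being the end of both $\omega^*$-chains and the beginning of the $\omega$-chain. Then every elementary first-order sentence $\varphi$ in the language $\{f\}$ that is true in $\mathcal{A}$ has limiting density $1$.
   Context: Explicitly, $\mathcal{A}$ has distinct elements $b_i$ ($i\ge 0$), $c_i$ ($i\ge0$), $d_i$ ($i\ge 1$), $e_i$ ($i\ge1$), with $f(b_i)=b_{i+1}$, $f(c_i)=c_{i+1}$, $f(d_{i+1})=d_i$, $f(e_{i+1})=e_i$, and $f(d_1)=f(e_1)=c_0$; the special point is $c_0$. The structure given by a presentation with generator $a$ and identity $f^{(r)}(a)=f^{(r')}(a)$ is the structure generated by $a$ in which the equations between terms $f^{(i)}(a)$ that hold are exactly the logical consequences of the identity. Identities are counted as ordered pairs $(r,r')$, and the length of the identity is $r+r'$. Let $P_s$ be the number of identities of length at most $s$ and $P_s(\varphi)$ the number of these whose resulting structure satisfies $\varphi$. The sentence $\varphi$ has limiting density $d$ if $\lim_{s\to\infty}P_s(\varphi)/P_s=d$. -}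

module Defs where

open import Data.Empty.Polymorphic using (⊥)
open import Data.Fin.Base using (Fin; zero)
open import Data.Integer.Base using (+_)
open import Data.List.Base using (List; cartesianProduct; filter; length; upTo)
open import Data.Nat.Base as ℕ using (ℕ; zero; suc; _+_)
open import Data.Nat.Properties using (_≤?_)
open import Data.Product.Base using (_×_; _,_; Σ-syntax; ∃-syntax)
open import Data.Rational.Base as ℚ using (ℚ; 0ℚ; _/_; _-_; ∣_∣)
open import Data.Sum.Base using (_⊎_)
open import Data.Vec.Base using (Vec; []; _∷_; lookup)
open import Function.Base using (_∘_)
open import Function.Bundles using (Func)
open import Level using (Level; Lift; 0ℓ; _⊔_) renaming (suc to lsuc)
open import Relation.Binary.Bundles using (Setoid)
open import Relation.Binary.PropositionalEquality.Core using (cong)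
open import Relation.Binary.PropositionalEquality.Properties using (setoid)
open import Relation.Unary using (Decidable)

private variable
  κ ℓ : Level
  n   : ℕ

-- Terms and formulas (with equality) in the language {f}, with n free
-- variables; variables are de Bruijn indices, `zero` being the one bound
-- by the innermost quantifier.  Negation is φ ⇒′ ⊥′.

data Term (n : ℕ) : Set where
  var : Fin n → Term n
  f·_ : Term n → Term n

infix  6 _≐_
infixr 5 _∧′_
infixr 4 _∨′_
infixr 3 _⇒′_
infix  2 ∀′_ ∃′_

data Formula : ℕ → Set where
  _≐_            : Term n → Term n → Formula n
  ⊥′             : Formula n
  _∧′_ _∨′_ _⇒′_ : Formula n → Formula n → Formula n
  ∀′_ ∃′_        : Formula (suc n) → Formula n

Sentence : Set
Sentence = Formula 0

-- The equality of a structure is a setoid equality, so that presented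
-- structures need no quotient types; `≐` is interpreted by it.

record Structure (κ ℓ : Level) : Set (lsuc (κ ⊔ ℓ)) where
  field
    elements : Setoid κ ℓ
    f        : Func elements elements
  open Setoid elements public using (Carrier; _≈_)

module _ (M : Structure κ ℓ) where
  open Structure M

  eval : Vec Carrier n → Term n → Carrier
  eval ρ (var x) = lookup ρ x
  eval ρ (f· t)  = Func.to f (eval ρ t)

  Sat : Vec Carrier n → Formula n → Set (κ ⊔ ℓ)
  Sat ρ (t ≐ u)  = Lift κ (eval ρ t ≈ eval ρ u)
  Sat ρ ⊥′       = ⊥
  Sat ρ (φ ∧′ ψ) = Sat ρ φ × Sat ρ ψ
  Sat ρ (φ ∨′ ψ) = Sat ρ φ ⊎ Sat ρ ψ
  Sat ρ (φ ⇒′ ψ) = Sat ρ φ → Sat ρ ψ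
  Sat ρ (∀′ φ)   = (x : Carrier) → Sat (x ∷ ρ) φ
  Sat ρ (∃′ φ)   = Σ[ x ∈ Carrier ] Sat (x ∷ ρ) φ

infix 1 _⊨_

_⊨_ : Structure κ ℓ → Sentence → Set (κ ⊔ ℓ)
M ⊨ φ = Sat M [] φ

-- Here `d i` and `e i` stand for the elements usually written dᵢ₊₁ and
-- eᵢ₊₁: the two ω*-chains are indexed from 1, the ω-chains from 0.

data Point : Set where
  b c d e : ℕ → Point

next : Point → Point
next (b i)       = b (suc i)
next (c i)       = c (suc i)
next (d zero)    = c 0
next (d (suc i)) = d i
next (e zero)    = c 0
next (e (suc i)) = e i

𝒜 : Structure 0ℓ 0ℓ
𝒜 = record
  { elements = setoid Point
  ; f        = record { to = next ; cong = cong next }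
  }

-- The generator a is the only variable of `Term 1`.

f^[_]a : ℕ → Term 1
f^[ zero  ]a = var zero
f^[ suc i ]a = f· f^[ i ]a

-- An identity f⁽ʳ⁾(a) = f⁽ʳ′⁾(a) is represented by the pair (r , r′).

Identity : Set
Identity = ℕ × ℕ

len : Identity → ℕ
len (r , r′) = r + r′

-- Logical consequence: t = u holds at every element of every structure at
-- which the identity holds.  Structures in higher universes would give
-- nothing more, since the term structure modulo the congruence generated
-- by the identity is already a `Structure 0ℓ 0ℓ`.

infix 4 _⊢_≈_

_⊢_≈_ : Identity → Term 1 → Term 1 → Set₁
(r , r′) ⊢ t ≈ u =
  (M : Structure 0ℓ 0ℓ) (let open Structure M) (a : Carrier) →
  eval M (a ∷ []) f^[ r ]a ≈ eval M (a ∷ []) f^[ r′ ]a →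
  eval M (a ∷ []) t ≈ eval M (a ∷ []) u

Presented : Identity → Structure 0ℓ (lsuc 0ℓ)
Presented p = record
  { elements = record
    { Carrier       = Term 1
    ; _≈_           = p ⊢_≈_
    ; isEquivalence = record
      { refl  = λ M _ _ → Setoid.refl (Structure.elements M)
      ; sym   = λ t≈u M a h → Setoid.sym (Structure.elements M) (t≈u M a h)
      ; trans = λ t≈u u≈v M a h →
                  Setoid.trans (Structure.elements M) (t≈u M a h) (u≈v M a h)
      }
    }
  ; f = record
    { to   = f·_
    ; cong = λ t≈u M a h → Func.cong (Structure.f M) (t≈u M a h)
    }
  }

-- The identities of length at most s; each has r, r′ ≤ s.

identities : ℕ → List Identity
identities s =
  filter (λ p → len p ≤? s) (cartesianProduct (upTo (suc s)) (upTo (suc s)))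

P : ℕ → ℕ
P s = length (identities s)

instance
  P-nonZero : ∀ {s} → ℕ.NonZero (P s)
  P-nonZero = _

-- Counting requires deciding; the count does not depend on the procedure.

P[_] : {Q : Identity → Set₁} → Decidable Q → ℕ → ℕ
P[ Q? ] s = length (filter Q? (identities s))

Converges : (ℕ → ℚ) → ℚ → Set
Converges u l =
  ∀ ε → 0ℚ ℚ.< ε → ∃[ N ] ∀ s → N ℕ.≤ s → ∣ u s - l ∣ ℚ.< ε

-- The existence of a decision procedure, classically automatic, says that
-- P_s(φ) is a well-defined number for every s.

HasLimitingDensity : Sentence → ℚ → Set₁
HasLimitingDensity φ δ =
  Σ[ sat? ∈ Decidable (λ p → Presented p ⊨ φ) ]
    Converges (λ s → + P[ sat? ] s / P s) δ

{-# OPTIONS --safe #-}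

-- If r ≠ r′, the presented structure is a lasso: a tail of length min(r, r′)
-- running into a cycle of length |r − r′|.  Cutting the edge that closes the
-- cycle leaves a single finite chain; cutting in 𝒜 the edge from e 0 to c 0
-- leaves an ω-chain, a ℤ-chain and an ω*-chain.  In both, f is the successor
-- along a chain, except that the last element is mapped to the marked middle
-- point.  An Ehrenfeucht–Fraïssé game in which
-- the distances between pebbles have to agree only up to a radius that is
-- halved at each move shows that a lasso whose tail and cycle are both long
-- satisfies φ as soon as 𝒜 does.  Only linearly many of the quadratically
-- many identities of length at most s fail to give such a lasso.
--
-- Satisfaction is decidable in a lasso because it is finite.  In the ω-chain
-- (r = r′) the same game shows that, beyond a bound depending on the
-- parameters, all elements satisfy the same formulas of a given rank.

module Submission where

open import Data.Empty using (⊥)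
open import Data.Fin.Base using (Fin; zero; suc; toℕ; fromℕ; fromℕ<; inject₁)
open import Data.Fin.Properties as Fin
  using (any?; ¬∀⟶∃¬; pigeonhole; injective⇒≤; toℕ-injective; toℕ-fromℕ; toℕ-fromℕ<; toℕ<n; toℕ≤pred[n])
open import Data.Integer.Base as ℤ using (ℤ; +_; -[1+_])
import Data.Integer.Properties as ℤ
open import Algebra.Properties.AbelianGroup ℤ.+-0-abelianGroup using (∙-cancelˡ; ∙-cancelʳ)
open import Data.List.Base as List
  using (List; []; _∷_; _++_; filter; length; lookup; upTo; allFin; cartesianProduct)
open import Data.List.Membership.Propositional using (_∈_)
open import Data.List.Membership.Propositional.Properties
open import Data.List.Properties using (length-++; length-map; length-upTo; length-filter)
open import Data.List.Relation.Binary.Subset.Propositional using (_⊆_)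
import Data.List.Relation.Unary.All as All
open import Data.List.Relation.Unary.AllPairs using (_∷_)
import Data.List.Relation.Unary.Any as Any
open import Data.List.Relation.Unary.Any.Properties using (lookup-index)
open import Data.List.Relation.Unary.Unique.Propositional using (Unique)
open import Data.List.Relation.Unary.Unique.Propositional.Properties
  using (upTo⁺; cartesianProduct⁺; filter⁺)
open import Data.Nat.Base
  using (ℕ; zero; suc; NonZero; _+_; _*_; _^_; _∸_; _⊔_; _≤_; _<_; s≤s; z≤n; z<s; s≤s⁻¹; ⌊_/2⌋;
         compare; less; equal; greater)
open import Data.Nat.Properties
open import Data.Nat.Solver using (module +-*-Solver)
open import Data.Product.Base using (Σ-syntax; ∃; _×_; _,_; proj₁; proj₂)
open import Data.Product.Function.NonDependent.Propositional using (_×-⇔_)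
open import Data.Rational.Base as ℚ using (mkℚ; 0ℚ; 1ℚ; toℚᵘ)
import Data.Rational.Properties as ℚ
open import Data.Rational.Unnormalised.Base as ℚᵘ using (mkℚᵘ; *<*)
import Data.Rational.Unnormalised.Properties as ℚᵘ
open import Data.Sum.Base using (_⊎_; inj₁; inj₂; [_,_]′; map₁)
open import Data.Sum.Function.Propositional using (_⊎-⇔_)
open import Data.Vec.Base as Vec using (Vec; []; _∷_)
import Data.Vec.Functional as F
import Data.Vec.Properties as Vec
open import Function.Base using (_∘_; id)
open import Function.Bundles using (Func; _⇔_; mk⇔; module Equivalence)
open import Function.Construct.Symmetry using (⇔-sym)
open import Function.Related.TypeIsomorphisms using (→-cong-⇔)
open import Level using (Level; 0ℓ; lift; lower)
open import Relation.Binary.Bundles using (Setoid)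
open import Relation.Binary.Definitions using (DecidableEquality)
open import Relation.Binary.PropositionalEquality hiding ([_])
open import Relation.Nullary using (¬_; Dec; yes; no; contradiction)
open import Relation.Nullary.Decidable as Dec using (_⊎-dec_; _×-dec_; _→-dec_)
open import Relation.Unary using (Decidable)
open import Defs

open Equivalence using (to; from)

private variable
  A B X Y : Set
  κ ℓ : Level
  k m n R R′ : ℕ

-- The game on chains

-- A disjoint union of discrete linear orders: x ↝[ q ] y means that y lies q
-- steps after x.  First and Last single out the endpoints, which may be
-- missing or occur on several components.
record Chain (X : Set) : Set₁ where
  infix 4 _↝[_]_
  field
    _↝[_]_    : X → ℕ → X → Set
    steps?    : ∀ x q y → Dec (x ↝[ q ] y)
    stay      : ∀ {x} → x ↝[ 0 ] x
    stay⁻¹    : ∀ {x y} → x ↝[ 0 ] y → x ≡ y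
    compose   : ∀ {x y z} p {q} → x ↝[ p ] y → y ↝[ q ] z → x ↝[ p + q ] z
    cancelˡ   : ∀ {x y z} p {q} → x ↝[ p ] y → x ↝[ p + q ] z → y ↝[ q ] z
    cancelʳ   : ∀ {x y z} p {q} → y ↝[ q ] z → x ↝[ p + q ] z → x ↝[ p ] y
    acyclic   : ∀ {x q} → x ↝[ q ] x → q ≡ 0
    First     : X → Set
    Last      : X → Set
    first-min : ∀ {x y q} → First x → y ↝[ q ] x → q ≡ 0
    last-max  : ∀ {x y q} → Last x → x ↝[ q ] y → q ≡ 0
    pred      : ∀ x → First x ⊎ ∃ λ y → y ↝[ 1 ] x
    succ      : ∀ x → Last x ⊎ ∃ λ y → x ↝[ 1 ] y

  steps : ∀ q x → (∃ λ y → x ↝[ q ] y) ⊎ (∃ λ p → ∃ λ l → p < q × Last l × x ↝[ p ] l)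
  steps zero    x = inj₁ (x , stay)
  steps (suc q) x with steps q x
  ... | inj₂ (p , l , p<q , last , x↝l) = inj₂ (p , l , m≤n⇒m≤1+n p<q , last , x↝l)
  ... | inj₁ (y , x↝y) with succ y
  ...   | inj₁ last      = inj₂ (q , y , ≤-refl , last , x↝y)
  ...   | inj₂ (z , y↝z) = inj₁ (z , subst (x ↝[_] z) (+-comm q 1) (compose q x↝y y↝z))

  steps-unique : ∀ {x y p q} → x ↝[ p ] y → x ↝[ q ] y → p ≡ q
  steps-unique {x} {y} {p} {q} x↝y x↝y′ with ≤-total p q
  ... | inj₁ p≤q = ≤-antisym p≤q (m∸n≡0⇒m≤n
          (acyclic (cancelˡ p x↝y (subst (x ↝[_] y) (sym (m+[n∸m]≡n p≤q)) x↝y′))))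
  ... | inj₂ q≤p = ≤-antisym (m∸n≡0⇒m≤n
          (acyclic (cancelˡ q x↝y′ (subst (x ↝[_] y) (sym (m+[n∸m]≡n q≤p)) x↝y)))) q≤p

  -- Reversal turns statements about successors into statements about predecessors, so the arguments
  -- about moves near a pebble are written once, for points after it.
  opposite : Chain X
  opposite = record
    { _↝[_]_    = λ x q y → y ↝[ q ] x
    ; steps?    = λ x q y → steps? y q x
    ; stay      = stay
    ; stay⁻¹    = sym ∘ stay⁻¹
    ; compose   = λ {x} {y} {z} p {q} y↝x z↝y →
                    subst (z ↝[_] x) (+-comm q p) (compose q z↝y y↝x)
    ; cancelˡ   = λ {x} {y} {z} p {q} y↝x z↝x →
                    cancelʳ q y↝x (subst (z ↝[_] x) (+-comm p q) z↝x)
    ; cancelʳ   = λ {x} {y} {z} p {q} z↝y z↝x →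
                    cancelˡ q z↝y (subst (z ↝[_] x) (+-comm p q) z↝x)
    ; acyclic   = acyclic
    ; First     = Last
    ; Last      = First
    ; first-min = last-max
    ; last-max  = first-min
    ; pred      = succ
    ; succ      = pred
    }

open Chain using (opposite)

module _ (C : Chain X) where
  open Chain C

  Far : ℕ → (Fin n → X) → X → Set
  Far R xs x = ∀ i {q} → q < R → ¬ (xs i ↝[ q ] x) × ¬ (x ↝[ q ] xs i)

  -- Provides the answer to a move far from every pebble; `K` caps the number of pebbles on the
  -- board.
  Spacious : ℕ → ℕ → Set
  Spacious K R = ∀ {n} → n ≤ K → (xs : Fin n → X) → ∃ (Far R xs)

  Far-mono : R ≤ R′ → {xs : Fin n → X} {x : X} → Far R′ xs x → Far R xs x
  Far-mono R≤R′ far i q<R = far i (<-≤-trans q<R R≤R′)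

  private
    Near : ℕ → X → X → Set
    Near R x y = (∃ λ q → q < R × x ↝[ q ] y) ⊎ (∃ λ q → q < R × y ↝[ q ] x)

    near? : ∀ R x y → Dec (Near R x y)
    near? R x y = anyUpTo? (λ q → steps? x q y) R ⊎-dec anyUpTo? (λ q → steps? y q x) R

    -- A triangle inequality. Two points on the same side of `z` are comparable because their common
    -- steps cancel; on opposite sides the steps add up.
    Near-centre : ∀ {z x y} → Near R z x → Near R z y → Near (R + R) x y
    Near-centre {R} {z} {x} {y} (inj₁ (p , p<R , z↝x)) (inj₁ (q , q<R , z↝y))
      with ≤-total p q
    ... | inj₁ p≤q = inj₁ (q ∸ p , ≤-<-trans (m∸n≤m q p) (<-≤-trans q<R (m≤m+n R R)) ,
            cancelˡ p z↝x (subst (z ↝[_] y) (sym (m+[n∸m]≡n p≤q)) z↝y))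
    ... | inj₂ q≤p = inj₂ (p ∸ q , ≤-<-trans (m∸n≤m p q) (<-≤-trans p<R (m≤m+n R R)) ,
            cancelˡ q z↝y (subst (z ↝[_] x) (sym (m+[n∸m]≡n q≤p)) z↝x))
    Near-centre (inj₁ (p , p<R , z↝x)) (inj₂ (q , q<R , y↝z)) =
      inj₂ (q + p , +-mono-< q<R p<R , compose q y↝z z↝x)
    Near-centre (inj₂ (p , p<R , x↝z)) (inj₁ (q , q<R , z↝y)) =
      inj₁ (p + q , +-mono-< p<R q<R , compose p x↝z z↝y)
    Near-centre {R} {z} {x} {y} (inj₂ (p , p<R , x↝z)) (inj₂ (q , q<R , y↝z))
      with ≤-total p q
    ... | inj₁ p≤q = inj₂ (q ∸ p , ≤-<-trans (m∸n≤m q p) (<-≤-trans q<R (m≤m+n R R)) ,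
            cancelʳ (q ∸ p) x↝z (subst (y ↝[_] z) (sym (m∸n+n≡m p≤q)) y↝z))
    ... | inj₂ q≤p = inj₁ (p ∸ q , ≤-<-trans (m∸n≤m p q) (<-≤-trans p<R (m≤m+n R R)) ,
            cancelʳ (p ∸ q) y↝z (subst (x ↝[_] z) (sym (m∸n+n≡m q≤p)) x↝z))

  -- Each of the given points is near at most one of the K + 1 spread-out
  -- points w, so some point of w is far from all of them.
  spread⇒spacious : ∀ {K} (w : Fin (suc K) → X) →
    (∀ i j → toℕ i < toℕ j → ∃ λ q → R + R ≤ q × w i ↝[ q ] w j) → Spacious K R
  spread⇒spacious {R} {K} w spread {n} n≤K xs =
      w t , λ i q<R → (λ x↝w → ¬near (i , inj₁ (_ , q<R , x↝w)))
                    , (λ w↝x → ¬near (i , inj₂ (_ , q<R , w↝x)))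
    where
    Hit : Fin (suc K) → Set
    Hit t = ∃ λ i → Near R (xs i) (w t)

    not-all : ¬ (∀ t → Hit t)
    not-all hits with i , j , i<j , same ← pigeonhole (s≤s n≤K) (proj₁ ∘ hits)
      with q , 2R≤q , wᵢ↝wⱼ ← spread i j i<j
      with Near-centre (proj₂ (hits i)) (subst (λ z → Near R (xs z) (w j)) (sym same) (proj₂ (hits j)))
    ... | inj₁ (p , p<2R , wᵢ↝wⱼ′) =
      <⇒≱ p<2R (subst (R + R ≤_) (steps-unique wᵢ↝wⱼ wᵢ↝wⱼ′) 2R≤q)
    ... | inj₂ (p , p<2R , wⱼ↝wᵢ) =
      <⇒≱ p<2R (≤-trans 2R≤q (subst (_≤ p) (sym (m+n≡0⇒m≡0 q (acyclic (compose q wᵢ↝wⱼ wⱼ↝wᵢ)))) z≤n))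

    miss : ∃ λ t → ¬ Hit t
    miss = ¬∀⟶∃¬ (suc K) Hit (λ t → any? (λ i → near? R (xs i) (w t))) not-all

    t = proj₁ miss
    ¬near = proj₂ miss

module _ (C : Chain X) (D : Chain Y) where
  private
    module C = Chain C
    module D = Chain D

  Agree : ℕ → (Fin n → X) → (Fin n → Y) → Set
  Agree R xs ys = ∀ i j {q} → q < R → xs i C.↝[ q ] xs j → ys i D.↝[ q ] ys j

  Agree-mono : R ≤ R′ → {xs : Fin n → X} {ys : Fin n → Y} → Agree R′ xs ys → Agree R xs ys
  Agree-mono R≤R′ agree i j q<R = agree i j (<-≤-trans q<R R≤R′)

  agree-∷-far : {xs : Fin n → X} {ys : Fin n → Y} {x : X} {y : Y} →
    Agree R xs ys → Far C R xs x → Agree R (x F.∷ xs) (y F.∷ ys)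
  agree-∷-far agree far zero    zero    q<R x↝x with refl ← C.acyclic x↝x = D.stay
  agree-∷-far agree far zero    (suc j) q<R x↝  = contradiction x↝ (proj₂ (far j q<R))
  agree-∷-far agree far (suc i) zero    q<R ↝x  = contradiction ↝x (proj₁ (far i q<R))
  agree-∷-far agree far (suc i) (suc j) q<R     = agree i j q<R

  -- This is where the radius halves: `x` is at most `R` steps from pebble `i`, so fewer than `R`
  -- steps between `x` and pebble `j` put the two pebbles fewer than `R + R` steps apart, where
  -- agreement is known.
  agree-∷-near : {xs : Fin n → X} {ys : Fin n → Y} {x : X} {y : Y} →
    Agree (R + R) xs ys → ∀ i {p} → p ≤ R → xs i C.↝[ p ] x → ys i D.↝[ p ] y →
    Agree R (x F.∷ xs) (y F.∷ ys)
  agree-∷-near agree i p≤R x↝ y↝ zero zero q<R x↝x with refl ← C.acyclic x↝x = D.stay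
  agree-∷-near agree i {p} p≤R x↝ y↝ zero (suc j) q<R x↝xⱼ =
    D.cancelˡ p y↝ (agree i j (+-mono-≤-< p≤R q<R) (C.compose p x↝ x↝xⱼ))
  agree-∷-near {R = R} {xs} {ys} {x} {y} agree i {p} p≤R x↝ y↝ (suc j) zero {q} q<R xⱼ↝x
    with ≤-total q p
  -- Here pebble `j` lies between pebble `i` and `x`; in the other case it lies at or before pebble
  -- `i`.
  ... | inj₁ q≤p =
    D.cancelˡ (p ∸ q)
      (agree i j (≤-<-trans (≤-trans (m∸n≤m p q) p≤R) (m<m+n R (≤-<-trans z≤n q<R)))
        (C.cancelʳ (p ∸ q) xⱼ↝x (subst (xs i C.↝[_] x) (sym (m∸n+n≡m q≤p)) x↝)))
      (subst (ys i D.↝[_] y) (sym (m∸n+n≡m q≤p)) y↝)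
  ... | inj₂ p≤q =
    subst (ys j D.↝[_] y) (m∸n+n≡m p≤q)
      (D.compose (q ∸ p)
        (agree j i (≤-<-trans (m∸n≤m q p) (<-≤-trans q<R (m≤m+n R R)))
          (C.cancelʳ (q ∸ p) x↝ (subst (xs j C.↝[_] x) (sym (m∸n+n≡m p≤q)) xⱼ↝x)))
        y↝)
  agree-∷-near {R = R} agree i p≤R x↝ y↝ (suc j) (suc l) q<R =
    agree j l (<-≤-trans q<R (m≤m+n R R))

Linked : (Fin n → X) → (Fin n → Y) → X → Y → Set
Linked xs ys x y = ∃ λ i → xs i ≡ x × ys i ≡ y

Linked-∷ : {xs : Fin n → X} {ys : Fin n → Y} {x₀ x : X} {y₀ y : Y} →
  Linked xs ys x y → Linked (x₀ F.∷ xs) (y₀ F.∷ ys) x y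
Linked-∷ (i , xᵢ≡x , yᵢ≡y) = suc i , xᵢ≡x , yᵢ≡y

-- Used for the endpoints: since they carry pebbles from the start, they correspond throughout the
-- game.
Covers : (X → Set) → (Y → Set) → (Fin n → X) → (Fin n → Y) → Set
Covers P Q xs ys = ∀ {x} → P x → ∃ λ y → Q y × Linked xs ys x y

Covers-∷ : {P : X → Set} {Q : Y → Set} {xs : Fin n → X} {ys : Fin n → Y} {x₀ : X} {y₀ : Y} →
  Covers P Q xs ys → Covers P Q (x₀ F.∷ xs) (y₀ F.∷ ys)
Covers-∷ covers Px with y , Qy , link ← covers Px = y , Qy , Linked-∷ link

module _ (C : Chain X) (D : Chain Y) where
  private
    module C = Chain C
    module D = Chain D

  -- If the chain through `ys i` ended after `q < p` steps, its last point would be a pebble whose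
  -- partner is last and, by agreement, `q` steps after `xs i`; yet a point lies `p` steps after
  -- `xs i`.
  follow : {xs : Fin n → X} {ys : Fin n → Y} → Agree D C R ys xs →
    Covers D.Last C.Last ys xs →
    ∀ i {p x} → p ≤ R → xs i C.↝[ p ] x → ∃ λ y → ys i D.↝[ p ] y
  follow {xs = xs} {ys} agree lasts i {p} {x} p≤R x↝ with D.steps p (ys i)
  ... | inj₁ found = found
  ... | inj₂ (q , l , q<p , last , y↝l) with l′ , last′ , j , refl , refl ← lasts last =
    contradiction
      (C.last-max last′
        (C.cancelˡ q (agree i j (<-≤-trans q<p p≤R) y↝l)
          (subst (xs i C.↝[_] x) (sym (m+[n∸m]≡n (<⇒≤ q<p))) x↝)))
      (m>n⇒m∸n≢0 q<p)

-- Glued chains and the back-and-forth argument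

record Glued : Set₁ where
  field
    {Carrier} : Set
    chain     : Chain Carrier
    f         : Carrier → Carrier
    mid       : Carrier
  open Chain chain public
  field
    glue : ∀ x → x ↝[ 1 ] f x ⊎ (Last x × f x ≡ mid)

algebra : (X → X) → Structure 0ℓ 0ℓ
algebra f = record
  { elements = setoid _
  ; f        = record { to = f ; cong = cong f }
  }

⟪_⟫ : Glued → Structure 0ℓ 0ℓ
⟪ G ⟫ = algebra (Glued.f G)

depth : Term n → ℕ
depth (var x) = 0
depth (f· t)  = suc (depth t)

-- Every application of `f` in an equation is charged one move, because its value is pebbled like a
-- quantified element.
rank : Formula n → ℕ
rank (t ≐ u)  = depth t + depth u
rank ⊥′       = 0
rank (φ ∧′ ψ) = rank φ ⊔ rank ψ
rank (φ ∨′ ψ) = rank φ ⊔ rank ψ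
rank (φ ⇒′ ψ) = rank φ ⊔ rank ψ
rank (∀′ φ)   = suc (rank φ)
rank (∃′ φ)   = suc (rank φ)

2^[1+k] : ∀ k → 2 ^ suc k ≡ 2 ^ k + 2 ^ k
2^[1+k] k = cong (λ i → 2 ^ k + i) (+-identityʳ (2 ^ k))

-- K bounds the number of pebbles, k is the number of moves left; a move
-- halves the radius up to which the two sides are required to agree.
record Position (K : ℕ) (G H : Glued) (k : ℕ) : Set where
  private
    module G = Glued G
    module H = Glued H
  field
    {size} : ℕ
    xs     : Fin size → G.Carrier
    ys     : Fin size → H.Carrier
    bound  : size + k ≤ K
    agree→ : Agree G.chain H.chain (2 ^ k) xs ys
    agree← : Agree H.chain G.chain (2 ^ k) ys xs
    first→ : Covers G.First H.First xs ys
    first← : Covers H.First G.First ys xs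
    last→  : Covers G.Last H.Last xs ys
    last←  : Covers H.Last G.Last ys xs
    mids   : Linked xs ys G.mid H.mid

module _ {K : ℕ} where
  open Position using (xs; ys)

  _~⟨_⟩_ : ∀ {G H} → Glued.Carrier G → Position K G H k → Glued.Carrier H → Set
  x ~⟨ 𝓅 ⟩ y = Linked (xs 𝓅) (ys 𝓅) x y

  Extends : ∀ {G H} → Position K G H m → Position K G H n → Set
  Extends 𝓅 𝓆 = ∀ {x y} → x ~⟨ 𝓅 ⟩ y → x ~⟨ 𝓆 ⟩ y

  module _ {G H : Glued} where
    private
      module G = Glued G
      module H = Glued H

    swap : Position K G H k → Position K H G k
    swap 𝓅 = record
      { xs = ys 𝓅 ; ys = xs 𝓅 ; bound = bound
      ; agree→ = agree← ; agree← = agree→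
      ; first→ = first← ; first← = first→
      ; last→ = last← ; last← = last→
      ; mids = let i , x≡ , y≡ = mids in i , y≡ , x≡
      }
      where open Position 𝓅

    swap-~ : (𝓅 : Position K G H k) → ∀ {x y} → x ~⟨ 𝓅 ⟩ y → y ~⟨ swap 𝓅 ⟩ x
    swap-~ 𝓅 (i , x≡ , y≡) = i , y≡ , x≡

    Position-mono : m ≤ n → Position K G H n → Position K G H m
    Position-mono m≤n 𝓅 = record
      { xs = xs 𝓅 ; ys = ys 𝓅
      ; bound = ≤-trans (+-monoʳ-≤ size m≤n) bound
      ; agree→ = Agree-mono G.chain H.chain (^-monoʳ-≤ 2 m≤n) agree→
      ; agree← = Agree-mono H.chain G.chain (^-monoʳ-≤ 2 m≤n) agree←
      ; first→ = first→ ; first← = first← ; last→ = last→ ; last← = last← ; mids = mids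
      }
      where open Position 𝓅

    -- Agreement at distance 0 is preservation of equality, and the radius `2 ^ k` is positive even
    -- when no move is left.
    ~-functional : (𝓅 : Position K G H k) → ∀ {x y y′} → x ~⟨ 𝓅 ⟩ y → x ~⟨ 𝓅 ⟩ y′ → y ≡ y′
    ~-functional {k} 𝓅 {x} (i , xᵢ≡x , refl) (j , xⱼ≡x , refl) =
      H.stay⁻¹ (Position.agree→ 𝓅 i j (m^n>0 2 k)
        (subst (xs 𝓅 i G.↝[ 0 ]_) (trans xᵢ≡x (sym xⱼ≡x)) G.stay))

    last-transport : (𝓅 : Position K G H k) → ∀ {x y} → G.Last x → x ~⟨ 𝓅 ⟩ y → H.Last y
    last-transport 𝓅 lastx x~y with z , lastz , x~z ← Position.last→ 𝓅 lastx =
      subst H.Last (~-functional 𝓅 x~z x~y) lastz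

  module _ {G H : Glued} where
    private
      module G = Glued G
      module H = Glued H

    record Answer (𝓅 : Position K G H (suc k)) (x : G.Carrier) (y : H.Carrier) : Set where
      constructor answer
      field
        next-position : Position K G H k
        extends       : Extends 𝓅 next-position
        linked        : x ~⟨ next-position ⟩ y

    module _ (𝓅 : Position K G H (suc k)) where
      open Position 𝓅 using
        (size; bound; agree→; agree←; first→; first←; last→; last←; mids)

      place : ∀ x y →
        Agree G.chain H.chain (2 ^ k) (x F.∷ xs 𝓅) (y F.∷ ys 𝓅) →
        Agree H.chain G.chain (2 ^ k) (y F.∷ ys 𝓅) (x F.∷ xs 𝓅) → Answer 𝓅 x y
      place x y a→ a← = answer
        (record
          { xs = x F.∷ xs 𝓅 ; ys = y F.∷ ys 𝓅
          ; bound  = subst (_≤ K) (+-suc size k) bound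
          ; agree→ = a→ ; agree← = a←
          ; first→ = Covers-∷ first→ ; first← = Covers-∷ first←
          ; last→  = Covers-∷ last→  ; last←  = Covers-∷ last←
          ; mids   = Linked-∷ mids
          })
        Linked-∷ (zero , refl , refl)

      private
        2^k≤2^[1+k] : 2 ^ k ≤ 2 ^ suc k
        2^k≤2^[1+k] = ^-monoʳ-≤ 2 (n≤1+n k)

        agree→₂ : Agree G.chain H.chain (2 ^ k + 2 ^ k) (xs 𝓅) (ys 𝓅)
        agree→₂ = subst (λ R → Agree G.chain H.chain R (xs 𝓅) (ys 𝓅)) (2^[1+k] k) agree→

        agree←₂ : Agree H.chain G.chain (2 ^ k + 2 ^ k) (ys 𝓅) (xs 𝓅)
        agree←₂ = subst (λ R → Agree H.chain G.chain R (ys 𝓅) (xs 𝓅)) (2^[1+k] k) agree←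

      place-far : ∀ x y → Far G.chain (2 ^ k) (xs 𝓅) x → Far H.chain (2 ^ k) (ys 𝓅) y →
        Answer 𝓅 x y
      place-far x y far far′ = place x y
        (agree-∷-far G.chain H.chain (Agree-mono G.chain H.chain 2^k≤2^[1+k] agree→) far)
        (agree-∷-far H.chain G.chain (Agree-mono H.chain G.chain 2^k≤2^[1+k] agree←) far′)

      place-after : ∀ i {p x y} → p ≤ 2 ^ k →
        xs 𝓅 i G.↝[ p ] x → ys 𝓅 i H.↝[ p ] y → Answer 𝓅 x y
      place-after i p≤ x↝ y↝ = place _ _
        (agree-∷-near G.chain H.chain agree→₂ i p≤ x↝ y↝)
        (agree-∷-near H.chain G.chain agree←₂ i p≤ y↝ x↝)

      place-before : ∀ i {p x y} → p ≤ 2 ^ k →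
        x G.↝[ p ] xs 𝓅 i → y H.↝[ p ] ys 𝓅 i → Answer 𝓅 x y
      place-before i p≤ ↝x ↝y = place _ _
        (λ s t → agree-∷-near (opposite G.chain) (opposite H.chain)
          (λ s t → agree→₂ t s) i p≤ ↝x ↝y t s)
        (λ s t → agree-∷-near (opposite H.chain) (opposite G.chain)
          (λ s t → agree←₂ t s) i p≤ ↝y ↝x t s)

      -- A point fewer than `2 ^ k` steps from a pebble is answered by the same displacement from
      -- the partner pebble, which exists by `follow`; any other point is answered by a point far
      -- from all pebbles.
      respond : Spacious H.chain K (2 ^ K) → ∀ x → ∃ (Answer 𝓅 x)
      respond spacious x
        with any? (λ i → anyUpTo? (λ q → G.steps? (xs 𝓅 i) q x) (2 ^ k))
           | any? (λ i → anyUpTo? (λ q → G.steps? x q (xs 𝓅 i)) (2 ^ k))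
      ... | yes (i , p , p<R , x↝) | _ =
        let y , y↝ = follow G.chain H.chain agree←₂ last← i (≤-trans (<⇒≤ p<R) (m≤m+n _ _)) x↝
        in y , place-after i (<⇒≤ p<R) x↝ y↝
      ... | no _ | yes (i , p , p<R , ↝x) =
        let y , ↝y = follow (opposite G.chain) (opposite H.chain) (λ s t → agree←₂ t s)
                       first← i (≤-trans (<⇒≤ p<R) (m≤m+n _ _)) ↝x
        in y , place-before i (<⇒≤ p<R) ↝x ↝y
      ... | no ¬after | no ¬before =
        -- Spaciousness is given at the fixed radius `2 ^ K`, which dominates the current `2 ^ k`.
        let y , far = spacious (≤-trans (m≤m+n size (suc k)) bound) (ys 𝓅)
            k≤K     = ≤-trans (n≤1+n k) (≤-trans (m≤n+m (suc k) size) bound)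
        in y , place-far x y
             (λ i {q} q<R → (λ x↝ → ¬after (i , q , q<R , x↝))
                          , (λ ↝x → ¬before (i , q , q<R , ↝x)))
             (Far-mono H.chain (^-monoʳ-≤ 2 k≤K) far)

      -- `f x` is either one step after the pebble `x` or equal to the pebble `mid`, so this move is
      -- always near a pebble. The mixed cases are impossible, since partners are last together.
      apply-f : ∀ {x y} → x ~⟨ 𝓅 ⟩ y → Answer 𝓅 (G.f x) (H.f y)
      apply-f {x} {y} (i , refl , refl) with G.glue x | H.glue y
      ... | inj₁ x↝ | inj₁ y↝ = place-after i (m^n>0 2 k) x↝ y↝
      ... | inj₂ (lastx , fx≡mid) | inj₂ (lasty , fy≡mid)
          with j , mx , my ← mids =
        subst₂ (Answer 𝓅) (trans mx (sym fx≡mid)) (trans my (sym fy≡mid))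
          (place-after j z≤n G.stay H.stay)
      ... | inj₁ x↝ | inj₂ (lasty , _) =
        contradiction (G.last-max (last-transport (swap 𝓅) lasty (i , refl , refl)) x↝) λ ()
      ... | inj₂ (lastx , _) | inj₁ y↝ =
        contradiction (H.last-max (last-transport 𝓅 lastx (i , refl , refl)) y↝) λ ()

  Matching : ∀ {G H} → Position K G H k →
    Vec (Glued.Carrier G) n → Vec (Glued.Carrier H) n → Set
  Matching 𝓅 ρ σ = ∀ v → Vec.lookup ρ v ~⟨ 𝓅 ⟩ Vec.lookup σ v

  Matching-∷ : ∀ {G H} {𝓅 : Position K G H m} {𝓆 : Position K G H k} {ρ : Vec _ n} {σ x y} →
    Extends 𝓅 𝓆 → x ~⟨ 𝓆 ⟩ y → Matching 𝓅 ρ σ → Matching 𝓆 (x ∷ ρ) (y ∷ σ)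
  Matching-∷ ext link match zero    = link
  Matching-∷ ext link match (suc v) = ext (match v)

  match-term : ∀ {G H} (t : Term n) {ρ σ} (𝓅 : Position K G H (depth t + k)) → Matching 𝓅 ρ σ →
    Σ[ 𝓆 ∈ Position K G H k ] Extends 𝓅 𝓆 × eval ⟪ G ⟫ ρ t ~⟨ 𝓆 ⟩ eval ⟪ H ⟫ σ t
  match-term (var v) 𝓅 match = 𝓅 , id , match v
  match-term {k = k} {G} {H} (f· t) 𝓅 match
    with 𝓆 , ext , link ← match-term t (Position-mono (≤-reflexive (+-suc (depth t) k)) 𝓅) match
    with answer 𝓇 ext′ link′ ← apply-f 𝓆 link = 𝓇 , ext′ ∘ ext , link′

  -- The two structures exchange roles at the antecedent of an implication and at a universal
  -- quantifier, whose challenge is a point of `H`; hence both sides are assumed spacious.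
  transfer : ∀ {G H} → Spacious (Glued.chain G) K (2 ^ K) → Spacious (Glued.chain H) K (2 ^ K) →
    (φ : Formula n) → rank φ ≤ k → (𝓅 : Position K G H k) →
    ∀ {ρ σ} → Matching 𝓅 ρ σ → Sat ⟪ G ⟫ ρ φ → Sat ⟪ H ⟫ σ φ
  transfer sG sH (t ≐ u) t+u≤k 𝓅 match (lift eq)
    -- Evaluating `t` leaves `depth u` moves for evaluating `u`. With zero moves left partners are
    -- still unique, which settles the equation.
    with 𝓆 , ext , linkt ← match-term {k = depth u + 0} t
           (Position-mono (≤-trans (≤-reflexive (cong (λ i → depth t + i) (+-identityʳ (depth u)))) t+u≤k) 𝓅) match
    with 𝓇 , ext′ , linku ← match-term u 𝓆 (ext ∘ match) =
    lift (~-functional 𝓇 (ext′ linkt) (subst (_~⟨ 𝓇 ⟩ _) (sym eq) linku))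
  transfer sG sH (φ ∧′ ψ) r≤k 𝓅 match (p , q) =
    transfer sG sH φ (m⊔n≤o⇒m≤o _ _ r≤k) 𝓅 match p ,
    transfer sG sH ψ (m⊔n≤o⇒n≤o _ _ r≤k) 𝓅 match q
  transfer sG sH (φ ∨′ ψ) r≤k 𝓅 match (inj₁ p) =
    inj₁ (transfer sG sH φ (m⊔n≤o⇒m≤o _ _ r≤k) 𝓅 match p)
  transfer sG sH (φ ∨′ ψ) r≤k 𝓅 match (inj₂ q) =
    inj₂ (transfer sG sH ψ (m⊔n≤o⇒n≤o _ _ r≤k) 𝓅 match q)
  transfer sG sH (φ ⇒′ ψ) r≤k 𝓅 match h p =
    transfer sG sH ψ (m⊔n≤o⇒n≤o _ _ r≤k) 𝓅 match
      (h (transfer sH sG φ (m⊔n≤o⇒m≤o _ _ r≤k) (swap 𝓅) (swap-~ 𝓅 ∘ match) p))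
  transfer sG sH (∀′ φ) (s≤s r≤k) 𝓅 match h y
    with x , answer 𝓆 ext link ← respond (swap 𝓅) sG y =
    transfer sG sH φ r≤k (swap 𝓆)
      (Matching-∷ {𝓅 = 𝓅} {𝓆 = swap 𝓆} (swap-~ 𝓆 ∘ ext ∘ swap-~ 𝓅) (swap-~ 𝓆 link) match) (h x)
  transfer sG sH (∃′ φ) (s≤s r≤k) 𝓅 match (x , p)
    with y , answer 𝓆 ext link ← respond 𝓅 sH x =
    y , transfer sG sH φ r≤k 𝓆 (Matching-∷ {𝓅 = 𝓅} {𝓆 = 𝓆} ext link match) p

-- Presented structures are lassos or the ω-chain

-- With integer positions inside numbered components, the laws about steps become cancellation in ℤ;
-- only endpoints and neighbours depend on which positions occur.
module Coordinates {X : Set} (component : X → ℕ) (position : X → ℤ)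
  (injective : ∀ {x y} → component x ≡ component y → position x ≡ position y → x ≡ y) where

  _↝[_]_ : X → ℕ → X → Set
  x ↝[ q ] y = component x ≡ component y × position y ≡ position x ℤ.+ + q

  steps? : ∀ x q y → Dec (x ↝[ q ] y)
  steps? x q y = (component x ≟ component y) ×-dec (position y ℤ.≟ position x ℤ.+ + q)

  stay : ∀ {x} → x ↝[ 0 ] x
  stay = refl , sym (ℤ.+-identityʳ _)

  stay⁻¹ : ∀ {x y} → x ↝[ 0 ] y → x ≡ y
  stay⁻¹ (same , p) = injective same (sym (trans p (ℤ.+-identityʳ _)))

  compose : ∀ {x y z} p {q} → x ↝[ p ] y → y ↝[ q ] z → x ↝[ p + q ] z
  compose {x} p {q} (same , eq) (same′ , eq′) =
    trans same same′ , trans eq′ (trans (cong (ℤ._+ + q) eq) (ℤ.+-assoc (position x) (+ p) (+ q)))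

  cancelˡ : ∀ {x y z} p {q} → x ↝[ p ] y → x ↝[ p + q ] z → y ↝[ q ] z
  cancelˡ {x} p {q} (same , eq) (same′ , eq′) =
    trans (sym same) same′ ,
    trans eq′ (trans (sym (ℤ.+-assoc (position x) (+ p) (+ q))) (cong (ℤ._+ + q) (sym eq)))

  cancelʳ : ∀ {x y z} p {q} → y ↝[ q ] z → x ↝[ p + q ] z → x ↝[ p ] y
  cancelʳ {x} {y} p {q} (same , eq) (same′ , eq′) =
    trans same′ (sym same) ,
    ∙-cancelʳ (+ q) (position y) (position x ℤ.+ + p)
      (trans (sym eq) (trans eq′ (sym (ℤ.+-assoc (position x) (+ p) (+ q)))))

  acyclic : ∀ {x q} → x ↝[ q ] x → q ≡ 0
  acyclic {x} {q} (_ , eq) = ℤ.+-injective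
    (∙-cancelˡ (position x) (+ q) (+ 0) (trans (sym eq) (sym (ℤ.+-identityʳ (position x)))))

  spread : ∀ {K} R (w : Fin (suc K) → X) → (∀ i j → component (w i) ≡ component (w j)) →
    (∀ i → position (w i) ≡ + (toℕ i * (R + R))) →
    ∀ i j → toℕ i < toℕ j → ∃ λ q → R + R ≤ q × w i ↝[ q ] w j
  spread R w same p i j i<j =
    (toℕ j ∸ toℕ i) * (R + R) ,
    ≤-trans (≤-reflexive (sym (+-identityʳ (R + R)))) (*-monoˡ-≤ (R + R) (m<n⇒0<n∸m i<j)) ,
    same i j ,
    trans (p j) (trans (cong +_ (trans (cong (_* (R + R)) (sym (m+[n∸m]≡n (<⇒≤ i<j))))
                                      (*-distribʳ-+ (R + R) (toℕ i) (toℕ j ∸ toℕ i))))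
                       (cong (ℤ._+ + ((toℕ j ∸ toℕ i) * (R + R))) (sym (p i))))

-- Deciding satisfaction

module _ {X : Set} {f : X → X} (_≟X_ : DecidableEquality X)
  (representatives : ∀ {n} (ρ : Vec X n) φ → ∃ λ xs →
     ∀ x → ∃ λ y → y ∈ xs × (Sat (algebra f) (x ∷ ρ) φ ⇔ Sat (algebra f) (y ∷ ρ) φ)) where

  -- A quantifier is decided by testing finitely many representatives, since every element agrees
  -- with one of them on the body.
  Sat? : ∀ (ρ : Vec X n) φ → Dec (Sat (algebra f) ρ φ)
  Sat? ρ (t ≐ u)  = Dec.map′ lift lower (eval (algebra f) ρ t ≟X eval (algebra f) ρ u)
  Sat? ρ ⊥′       = no λ ()
  Sat? ρ (φ ∧′ ψ) = Sat? ρ φ ×-dec Sat? ρ ψ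
  Sat? ρ (φ ∨′ ψ) = Sat? ρ φ ⊎-dec Sat? ρ ψ
  Sat? ρ (φ ⇒′ ψ) = Sat? ρ φ →-dec Sat? ρ ψ
  Sat? ρ (∀′ φ) with xs , rep ← representatives ρ φ =
    Dec.map′
      (λ h x → let y , y∈xs , eqv = rep x in from eqv (All.lookup h y∈xs))
      (λ h → All.tabulate λ {x} _ → h x)
      (All.all? (λ x → Sat? (x ∷ ρ) φ) xs)
  Sat? ρ (∃′ φ) with xs , rep ← representatives ρ φ =
    Dec.map′
      Any.satisfied
      (λ (x , p) → let y , y∈xs , eqv = rep x in
         Any.map (λ y≡ → subst (λ z → Sat (algebra f) (z ∷ ρ) φ) y≡ (to eqv p)) y∈xs)
      (Any.any? (λ x → Sat? (x ∷ ρ) φ) xs)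

-- Isomorphisms and normal forms of terms

module _ (M : Structure κ ℓ) {X : Set} (f : X → X) where
  private module M = Structure M

  module _ (h : M.Carrier → X) (h-f : ∀ x → h (Func.to M.f x) ≡ f (h x))
    (preserves : ∀ {x y} → x M.≈ y → h x ≡ h y) (reflects : ∀ {x y} → h x ≡ h y → x M.≈ y)
    (surjective : ∀ y → ∃ λ x → h x ≡ y) where

    iso-eval : ∀ (ρ : Vec M.Carrier n) t → h (eval M ρ t) ≡ eval (algebra f) (Vec.map h ρ) t
    iso-eval ρ (var v) = sym (Vec.lookup-map v h ρ)
    iso-eval ρ (f· t)  = trans (h-f _) (cong f (iso-eval ρ t))

    iso-Sat : ∀ (ρ : Vec M.Carrier n) φ → Sat M ρ φ ⇔ Sat (algebra f) (Vec.map h ρ) φ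
    iso-Sat ρ (t ≐ u) = mk⇔
      (λ (lift eq) → lift (trans (sym (iso-eval ρ t)) (trans (preserves eq) (iso-eval ρ u))))
      (λ (lift eq) → lift (reflects (trans (iso-eval ρ t) (trans eq (sym (iso-eval ρ u))))))
    iso-Sat ρ ⊥′       = mk⇔ (λ ()) (λ ())
    iso-Sat ρ (φ ∧′ ψ) = iso-Sat ρ φ ×-⇔ iso-Sat ρ ψ
    iso-Sat ρ (φ ∨′ ψ) = iso-Sat ρ φ ⊎-⇔ iso-Sat ρ ψ
    iso-Sat ρ (φ ⇒′ ψ) = →-cong-⇔ (iso-Sat ρ φ) (iso-Sat ρ ψ)
    iso-Sat ρ (∀′ φ)   = mk⇔
      (λ g y → let x , hx≡y = surjective y in
         subst (λ z → Sat (algebra f) (z ∷ Vec.map h ρ) φ) hx≡y (to (iso-Sat (x ∷ ρ) φ) (g x)))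
      (λ g x → from (iso-Sat (x ∷ ρ) φ) (g (h x)))
    iso-Sat ρ (∃′ φ)   = mk⇔
      (λ (x , p) → h x , to (iso-Sat (x ∷ ρ) φ) p)
      (λ (y , p) → let x , hx≡y = surjective y in
         x , from (iso-Sat (x ∷ ρ) φ)
               (subst (λ z → Sat (algebra f) (z ∷ Vec.map h ρ) φ) (sym hx≡y) p))

-- `code x` is the exponent of the normal form that names `x` when the generator is interpreted as
-- `o`.
module _ (p : Identity) {X : Set} (f : X → X) (o : X) (code : X → ℕ) where

  value : Term 1 → X
  value = eval (algebra f) (o ∷ [])

  module _ (identity-holds : value f^[ proj₁ p ]a ≡ value f^[ proj₂ p ]a)
    (code-o : code o ≡ 0) (value-code : ∀ x → value f^[ code x ]a ≡ x)
    (code-f : ∀ x → p ⊢ f^[ suc (code x) ]a ≈ f^[ code (f x) ]a) where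

    normalise : ∀ t → p ⊢ t ≈ f^[ code (value t) ]a
    normalise (var zero) M a h =
      Setoid.reflexive (Structure.elements M) (cong (λ i → eval M (a ∷ []) f^[ i ]a) (sym code-o))
    normalise (f· t) M a h =
      Setoid.trans (Structure.elements M) (Func.cong (Structure.f M) (normalise t M a h))
        (code-f (value t) M a h)

    -- Evaluation at `o` is the isomorphism. It respects consequences because the identity holds at
    -- `o`; terms with equal values are both provably equal to the same normal form.
    Presented-⊨ : ∀ φ → (Presented p ⊨ φ) ⇔ (algebra f ⊨ φ)
    Presented-⊨ = iso-Sat (Presented p) f value (λ _ → refl)
      (λ t≈u → t≈u (algebra f) o identity-holds)
      (λ {t} {u} eq M a h → Setoid.trans (Structure.elements M) (normalise t M a h)
        (subst (λ x → Structure._≈_ M (eval M (a ∷ []) f^[ code x ]a) (eval M (a ∷ []) u)) (sym eq)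
          (Setoid.sym (Structure.elements M) (normalise u M a h))))
      (λ x → f^[ code x ]a , value-code x)
      []

-- The ω-chain

ω : Glued
ω = record
  { chain = record
    { Coordinates (λ _ → 0) +_ (λ _ → ℤ.+-injective)
    ; First     = _≡ 0
    ; Last      = λ _ → ⊥
    ; first-min = λ { {y = y} refl (_ , eq) → m+n≡0⇒n≡0 y (sym (ℤ.+-injective eq)) }
    ; last-max  = λ ()
    ; pred      = λ { zero → inj₁ refl
                    ; (suc x) → inj₂ (x , refl , cong +_ (+-comm 1 x)) }
    ; succ      = λ x → inj₂ (suc x , refl , cong +_ (+-comm 1 x))
    }
  ; f    = suc
  ; mid  = 0  -- a dummy: there is no last element to be sent to it
  ; glue = λ x → inj₁ (refl , cong +_ (+-comm 1 x))
  }

ω-spacious : ∀ {K R} → Spacious (Glued.chain ω) K R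
ω-spacious {K} {R} = spread⇒spacious (Glued.chain ω) w
  (Coordinates.spread (λ _ → 0) +_ (λ _ → ℤ.+-injective) R w (λ _ _ → refl) (λ _ → refl))
  where
  w : Fin (suc K) → ℕ
  w i = toℕ i * (R + R)

-- The same pebbles stand on both sides: `mid` and the parameters. As `mid` is the only possible
-- endpoint, its pebble covers the endpoints too.
diagonal : ∀ {G K k} (ρ : Vec (Glued.Carrier G) n) → (∀ {x} → Glued.First G x → x ≡ Glued.mid G) →
  (∀ {x} → Glued.Last G x → x ≡ Glued.mid G) → suc n + k ≤ K → Position K G G k
diagonal {G = G} ρ first last bound = record
  { xs = xs ; ys = xs ; bound = bound
  ; agree→ = λ _ _ _ → id ; agree← = λ _ _ _ → id
  ; first→ = cover first ; first← = cover first
  ; last→ = cover last ; last← = cover last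
  ; mids = zero , refl , refl
  }
  where
  xs = Glued.mid G F.∷ Vec.lookup ρ

  cover : ∀ {P : Glued.Carrier G → Set} → (∀ {x} → P x → x ≡ Glued.mid G) → Covers P P xs xs
  cover only Px with refl ← only Px = _ , Px , zero , refl , refl

lookup≤sum : ∀ (ρ : Vec ℕ n) v → Vec.lookup ρ v ≤ Vec.sum ρ
lookup≤sum (x ∷ ρ) zero    = m≤m+n x (Vec.sum ρ)
lookup≤sum (x ∷ ρ) (suc v) = ≤-trans (lookup≤sum ρ v) (m≤n+m (Vec.sum ρ) x)

module _ (ρ : Vec ℕ n) (φ : Formula (suc n)) where

  private
    -- The sum bounds all parameters at once; `2 ^ rank φ` is the radius in force after one move
    -- from `start`.
    horizon : ℕ
    horizon = Vec.sum ρ + 2 ^ rank φ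

    start : Position (suc n + suc (rank φ)) ω ω (suc (rank φ))
    start = diagonal ρ id (λ ()) ≤-refl

    far : ∀ {x} → horizon ≤ x → Far (Glued.chain ω) (2 ^ rank φ) (0 F.∷ Vec.lookup ρ) x
    far {x} h≤x i {q} q<R =
      (λ (_ , eq) → <⇒≱ (+-mono-≤-< (pebble≤ i) q<R)
        (≤-trans h≤x (≤-reflexive (ℤ.+-injective eq)))) ,
      (λ (_ , eq) → <⇒≱ (≤-<-trans (pebble≤ i) (m<m+n (Vec.sum ρ) (m^n>0 2 (rank φ))))
        (≤-trans h≤x (≤-trans (m≤m+n x q) (≤-reflexive (sym (ℤ.+-injective eq))))))
      where
      pebble≤ : ∀ i → (0 F.∷ Vec.lookup ρ) i ≤ Vec.sum ρ
      pebble≤ zero    = z≤n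
      pebble≤ (suc v) = lookup≤sum ρ v

    -- Both points are far from 0 and from the parameters, so each may answer the other. This spends
    -- the extra move of `start` and leaves `rank φ` moves for the formula.
    beyond-horizon : ∀ {x y} → horizon ≤ x → horizon ≤ y →
      Sat (algebra suc) (x ∷ ρ) φ → Sat (algebra suc) (y ∷ ρ) φ
    beyond-horizon {x} {y} h≤x h≤y
      with answer 𝓆 ext link ← place-far start x y (far h≤x) (far h≤y) =
      transfer {G = ω} {H = ω} ω-spacious ω-spacious φ ≤-refl 𝓆
        (Matching-∷ {𝓅 = start} {𝓆 = 𝓆} ext link (λ v → suc v , refl , refl))

  ω-representatives : ∃ λ xs → ∀ x → ∃ λ y → y ∈ xs ×
    (Sat (algebra suc) (x ∷ ρ) φ ⇔ Sat (algebra suc) (y ∷ ρ) φ)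
  ω-representatives = upTo (suc horizon) , representative
    where
    representative : ∀ x → ∃ λ y → y ∈ upTo (suc horizon) ×
      (Sat (algebra suc) (x ∷ ρ) φ ⇔ Sat (algebra suc) (y ∷ ρ) φ)
    representative x with ≤-total x horizon
    ... | inj₁ x≤h = x , ∈-upTo⁺ (s≤s x≤h) , mk⇔ id id
    ... | inj₂ h≤x = horizon , ∈-upTo⁺ ≤-refl ,
            mk⇔ (beyond-horizon h≤x ≤-refl) (beyond-horizon ≤-refl h≤x)

-- The lasso with tail length m and cycle length k + 1.
module Lasso (m k : ℕ) where

  mid : Fin (suc (m + k))
  mid = fromℕ< (s≤s (m≤m+n m k))

  toℕ-mid : toℕ mid ≡ m
  toℕ-mid = toℕ-fromℕ< _

  advance : Fin (suc (m + k)) → Fin (suc (m + k))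
  advance i with toℕ i <? m + k
  ... | yes i<m+k = fromℕ< (s≤s i<m+k)
  ... | no  _     = mid

  advance-spec : ∀ i → toℕ (advance i) ≡ suc (toℕ i) ⊎ (toℕ i ≡ m + k × advance i ≡ mid)
  advance-spec i with toℕ i <? m + k
  ... | yes i<m+k = inj₁ (toℕ-fromℕ< (s≤s i<m+k))
  ... | no  i≮m+k = inj₂ (≤-antisym (toℕ≤pred[n] i) (≮⇒≥ i≮m+k) , refl)

  open Coordinates {Fin (suc (m + k))} (λ _ → 0) (+_ ∘ toℕ) (λ _ → toℕ-injective ∘ ℤ.+-injective) public

  step : ∀ {i j} → toℕ j ≡ suc (toℕ i) → i ↝[ 1 ] j
  step {i} eq = refl , cong +_ (trans eq (+-comm 1 (toℕ i)))

  lasso : Glued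
  lasso = record
    { chain = record
      { Coordinates {Fin (suc (m + k))} (λ _ → 0) (+_ ∘ toℕ) (λ _ → toℕ-injective ∘ ℤ.+-injective)
      ; First     = λ i → toℕ i ≡ 0
      ; Last      = λ i → toℕ i ≡ m + k
      ; first-min = λ { {y = y} i≡0 (_ , eq) → m+n≡0⇒n≡0 (toℕ y) (trans (sym (ℤ.+-injective eq)) i≡0) }
      ; last-max  = λ { {x} {y} {q} i≡m+k (_ , eq) → n≤0⇒n≡0 (+-cancelˡ-≤ (toℕ x) q 0
                      (≤-trans (≤-reflexive (sym (ℤ.+-injective eq)))
                        (≤-trans (toℕ≤pred[n] y)
                          (≤-reflexive (trans (sym i≡m+k) (sym (+-identityʳ (toℕ x)))))))) }
      ; pred      = λ { zero → inj₁ refl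
                      ; i@(suc j) → inj₂ (inject₁ j ,
                          step {inject₁ j} {i} (cong suc (sym (Fin.toℕ-inject₁ j)))) }
      ; succ      = λ i → [ (λ eq → inj₂ (advance i , step {i} eq)) , inj₁ ∘ proj₁ ]′ (advance-spec i)
      }
    ; f    = advance
    ; mid  = mid
    ; glue = λ i → map₁ (step {i}) (advance-spec i)
    }

  lasso-spacious : ∀ {K R} → K * (R + R) ≤ m + k → Spacious (Glued.chain lasso) K R
  lasso-spacious {K} {R} KD≤m+k = spread⇒spacious (Glued.chain lasso) w
    (spread R w (λ _ _ → refl) (λ i → cong +_ (toℕ-fromℕ< _)))
    where
    w : Fin (suc K) → Fin (suc (m + k))
    w i = fromℕ< (s≤s (≤-trans (*-monoˡ-≤ (R + R) (toℕ≤pred[n] i)) KD≤m+k))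

  lasso-Sat? : ∀ (ρ : Vec (Fin (suc (m + k))) n) φ → Dec (Sat (algebra advance) ρ φ)
  lasso-Sat? = Sat? Fin._≟_ (λ _ _ → allFin _ , λ x → x , ∈-allFin x , mk⇔ id id)

  orbit : ∀ i → i ≤ m + k → toℕ (eval (algebra advance) (zero ∷ []) f^[ i ]a) ≡ i
  orbit zero    _     = refl
  orbit (suc i) i<m+k with advance-spec (eval (algebra advance) (zero ∷ []) f^[ i ]a)
  ... | inj₁ eq        = trans eq (cong suc (orbit i (<⇒≤ i<m+k)))
  ... | inj₂ (end , _) = contradiction (trans (sym (orbit i (<⇒≤ i<m+k))) end) (<⇒≢ i<m+k)

  orbit-returns :
    eval (algebra advance) (zero ∷ []) f^[ m ]a ≡ eval (algebra advance) (zero ∷ []) f^[ suc (m + k) ]a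
  orbit-returns with advance-spec (eval (algebra advance) (zero ∷ []) f^[ m + k ]a)
  ... | inj₁ eq       = contradiction (trans eq (cong suc (orbit (m + k) ≤-refl)))
                          (<⇒≢ (toℕ<n (advance (eval (algebra advance) (zero ∷ []) f^[ m + k ]a))))
  ... | inj₂ (_ , eq) = trans (toℕ-injective (trans (orbit m (m≤m+n m k)) (sym toℕ-mid))) (sym eq)

  -- A general `p` lets this serve both orientations of the identity. Before the last point it is
  -- reflexivity; at the last point it is the identity itself, read backwards.
  lasso-code : ∀ p → p ⊢ f^[ m ]a ≈ f^[ suc (m + k) ]a →
    ∀ i → p ⊢ f^[ suc (toℕ i) ]a ≈ f^[ toℕ (advance i) ]a
  lasso-code _ returns i M a h with advance-spec i
  ... | inj₁ eq = Setoid.reflexive (Structure.elements M) (cong (λ j → eval M (a ∷ []) f^[ j ]a) (sym eq))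
  ... | inj₂ (end , back) = Setoid.sym (Structure.elements M)
          (subst₂ (λ j j′ → Structure._≈_ M (eval M (a ∷ []) f^[ j ]a) (eval M (a ∷ []) f^[ j′ ]a))
            (sym (trans (cong toℕ back) toℕ-mid)) (cong suc (sym end)) (returns M a h))

  Presented-lasso : ∀ φ → (Presented (m , suc (m + k)) ⊨ φ) ⇔ (algebra advance ⊨ φ)
  Presented-lasso = Presented-⊨ (m , suc (m + k)) advance zero toℕ orbit-returns refl
    (λ x → toℕ-injective (orbit (toℕ x) (toℕ≤pred[n] x))) (lasso-code (m , suc (m + k)) λ _ _ → id)

  Presented-lassoᵒ : ∀ φ → (Presented (suc (m + k) , m) ⊨ φ) ⇔ (algebra advance ⊨ φ)
  Presented-lassoᵒ = Presented-⊨ (suc (m + k) , m) advance zero toℕ (sym orbit-returns) refl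
    (λ x → toℕ-injective (orbit (toℕ x) (toℕ≤pred[n] x)))
    (lasso-code (suc (m + k) , m) λ M _ → Setoid.sym (Structure.elements M))

Presented-ω : ∀ r φ → (Presented (r , r) ⊨ φ) ⇔ (algebra suc ⊨ φ)
Presented-ω r = Presented-⊨ (r , r) suc 0 id refl refl value-id
  (λ i M _ _ → Setoid.refl (Structure.elements M))
  where
  value-id : ∀ i → eval (algebra suc) (0 ∷ []) f^[ i ]a ≡ i
  value-id zero    = refl
  value-id (suc i) = cong suc (value-id i)

Presented? : ∀ φ p → Dec (Presented p ⊨ φ)
Presented? φ (r , r′) with compare r r′
-- The larger exponent is `suc (m + k)`, which gives tail `m` and cycle length `k + 1`.
... | less m k    = Dec.map (⇔-sym (Lasso.Presented-lasso m k φ)) (Lasso.lasso-Sat? m k [] φ)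
... | greater m k = Dec.map (⇔-sym (Lasso.Presented-lassoᵒ m k φ)) (Lasso.lasso-Sat? m k [] φ)
... | equal r     = Dec.map (⇔-sym (Presented-ω r φ)) (Sat? _≟_ ω-representatives [] φ)

-- Comparing `𝒜` with long lassos

component : Point → ℕ
component (b _) = 0
component (c _) = 1
component (d _) = 1
component (e _) = 2

-- As `-[1+ i ]` is -(i + 1), `d 0` comes just before `c 0` in their common component.
position : Point → ℤ
position (b i) = + i
position (c i) = + i
position (d i) = -[1+ i ]
position (e i) = -[1+ i ]

coordinates-injective : ∀ {x y} → component x ≡ component y → position x ≡ position y → x ≡ y
coordinates-injective {b _} {b _} _ refl = refl
coordinates-injective {c _} {c _} _ refl = refl
coordinates-injective {d _} {d _} _ refl = refl
coordinates-injective {e _} {e _} _ refl = refl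
coordinates-injective {b _} {c _} ()
coordinates-injective {b _} {d _} ()
coordinates-injective {b _} {e _} ()
coordinates-injective {c _} {b _} ()
coordinates-injective {c _} {d _} _ ()
coordinates-injective {c _} {e _} ()
coordinates-injective {d _} {b _} ()
coordinates-injective {d _} {c _} _ ()
coordinates-injective {d _} {e _} ()
coordinates-injective {e _} {b _} ()
coordinates-injective {e _} {c _} ()
coordinates-injective {e _} {d _} ()

module 𝒜 = Coordinates component position coordinates-injective

next-step : ∀ x → x 𝒜.↝[ 1 ] next x ⊎ (x ≡ e 0 × next x ≡ c 0)
next-step (b i)       = inj₁ (refl , cong +_ (+-comm 1 i))
next-step (c i)       = inj₁ (refl , cong +_ (+-comm 1 i))
next-step (d zero)    = inj₁ (refl , refl)
next-step (d (suc i)) = inj₁ (refl , refl)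
next-step (e zero)    = inj₂ (refl , refl)
next-step (e (suc i)) = inj₁ (refl , refl)

𝒜-glued : Glued
𝒜-glued = record
  { chain = record
    { Coordinates component position coordinates-injective
    ; First     = _≡ b 0
    ; Last      = _≡ e 0
    ; first-min = λ { {y = b i} refl (_ , eq) → m+n≡0⇒n≡0 i (sym (ℤ.+-injective eq)) }
    ; last-max  = λ { {y = e i} {zero} refl _ → refl
                    ; {y = e i} {suc q} refl (_ , ()) }
    ; pred      = λ { (b zero)    → inj₁ refl
                    ; (b (suc i)) → inj₂ (b i , refl , cong +_ (+-comm 1 i))
                    ; (c zero)    → inj₂ (d 0 , refl , refl)
                    ; (c (suc i)) → inj₂ (c i , refl , cong +_ (+-comm 1 i))
                    ; (d i)       → inj₂ (d (suc i) , refl , refl)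
                    ; (e i)       → inj₂ (e (suc i) , refl , refl) }
    ; succ      = λ x → [ (λ s → inj₂ (next x , s)) , inj₁ ∘ proj₁ ]′ (next-step x)
    }
  ; f    = next
  ; mid  = c 0
  ; glue = next-step
  }

𝒜-spacious : ∀ {K R} → Spacious (Glued.chain 𝒜-glued) K R
𝒜-spacious {K} {R} = spread⇒spacious (Glued.chain 𝒜-glued) w (𝒜.spread R w (λ _ _ → refl) (λ _ → refl))
  where
  w : Fin (suc K) → Point
  w i = b (toℕ i * (R + R))

-- When distinct pebbles are never fewer than `R` steps apart, only the zero steps from a pebble to
-- itself have to be matched.
scattered⇒agree : (C : Chain X) (D : Chain Y) {xs : Fin n → X} {ys : Fin n → Y} → ∀ {R} →
  (∀ i j {q} → q < R → Chain._↝[_]_ C (xs i) q (xs j) → i ≡ j) → Agree C D R xs ys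
scattered⇒agree C D scattered i j q<R x↝ with refl ← scattered i j q<R x↝
  with refl ← Chain.acyclic C x↝ = Chain.stay D

module _ (m k : ℕ) {K j : ℕ} (3+j≤K : 3 + j ≤ K) (2ʲ≤m : 2 ^ j ≤ m) (2ʲ≤k : 2 ^ j ≤ k) where
  open Lasso m k using (lasso; mid; toℕ-mid)

  private
    last : Fin (suc (m + k))
    last = fromℕ (m + k)

    xs : Fin 3 → Point
    xs = b 0 F.∷ c 0 F.∷ e 0 F.∷ F.[]

    ys : Fin 3 → Fin (suc (m + k))
    ys = zero F.∷ mid F.∷ last F.∷ F.[]

    scattered-xs : ∀ i i′ {q} → q < 2 ^ j → xs i 𝒜.↝[ q ] xs i′ → i ≡ i′
    scattered-xs zero             zero             _ _ = refl
    scattered-xs (suc zero)       (suc zero)       _ _ = refl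
    scattered-xs (suc (suc zero)) (suc (suc zero)) _ _ = refl
    scattered-xs zero             (suc zero)       _ (() , _)
    scattered-xs zero             (suc (suc zero)) _ (() , _)
    scattered-xs (suc zero)       zero             _ (() , _)
    scattered-xs (suc zero)       (suc (suc zero)) _ (() , _)
    scattered-xs (suc (suc zero)) zero             _ (() , _)
    scattered-xs (suc (suc zero)) (suc zero)       _ (() , _)

    0<m : 0 < m
    0<m = ≤-trans (m^n>0 2 j) 2ʲ≤m

    0<k : 0 < k
    0<k = ≤-trans (m^n>0 2 j) 2ʲ≤k

    scattered-ys : ∀ i i′ {q} → q < 2 ^ j → Lasso._↝[_]_ m k (ys i) q (ys i′) → i ≡ i′
    scattered-ys i i′ {q} q<2ʲ (_ , eq) = check i i′ (ℤ.+-injective eq)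
      where
      check : ∀ i i′ → toℕ (ys i′) ≡ toℕ (ys i) + q → i ≡ i′
      check zero             zero             _ = refl
      check (suc zero)       (suc zero)       _ = refl
      check (suc (suc zero)) (suc (suc zero)) _ = refl
      check zero             (suc zero)       eq = contradiction
        (≤-trans 2ʲ≤m (≤-reflexive (trans (sym toℕ-mid) eq))) (<⇒≱ q<2ʲ)
      check zero             (suc (suc zero)) eq = contradiction
        (≤-trans 2ʲ≤m (≤-trans (m≤m+n m k) (≤-reflexive (trans (sym (toℕ-fromℕ (m + k))) eq)))) (<⇒≱ q<2ʲ)
      check (suc zero)       zero             eq = contradiction
        (trans (sym toℕ-mid) (m+n≡0⇒m≡0 _ (sym eq))) (>⇒≢ 0<m)
      check (suc zero)       (suc (suc zero)) eq = contradiction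
        (≤-trans 2ʲ≤k (≤-reflexive (+-cancelˡ-≡ m k q
          (trans (sym (toℕ-fromℕ (m + k))) (trans eq (cong (_+ q) toℕ-mid)))))) (<⇒≱ q<2ʲ)
      check (suc (suc zero)) zero             eq = contradiction
        (m+n≡0⇒m≡0 m (trans (sym (toℕ-fromℕ (m + k))) (m+n≡0⇒m≡0 _ (sym eq)))) (>⇒≢ 0<m)
      check (suc (suc zero)) (suc zero)       eq = contradiction
        (≤-trans (m≤m+n (m + k) q) (≤-reflexive (trans (cong (_+ q) (sym (toℕ-fromℕ (m + k)))) (trans (sym eq) toℕ-mid))))
        (<⇒≱ (m<m+n m 0<k))

  -- The pebbles mark the first point, `mid` and the last point. In `𝒜` these lie on three
  -- components; in the lasso they stand at 0, `m` and `m + k`, with both gaps at least `2 ^ j`.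
  opening : Position K 𝒜-glued lasso j
  opening = record
    { xs = xs ; ys = ys ; bound = 3+j≤K
    ; agree→ = scattered⇒agree (Glued.chain 𝒜-glued) (Glued.chain lasso) scattered-xs
    ; agree← = scattered⇒agree (Glued.chain lasso) (Glued.chain 𝒜-glued) scattered-ys
    ; first→ = λ { refl → zero , refl , zero , refl , refl }
    ; first← = λ { {zero} refl → b 0 , refl , zero , refl , refl }
    ; last→  = λ { refl → last , toℕ-fromℕ (m + k) , suc (suc zero) , refl , refl }
    ; last←  = λ i≡m+k → e 0 , refl , suc (suc zero) ,
                 toℕ-injective (trans (toℕ-fromℕ (m + k)) (sym i≡m+k)) , refl
    ; mids   = suc zero , refl , refl
    }

-- `K` counts the three opening pebbles and one more per move. A chain with `K * (2 ^ K + 2 ^ K)`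
-- steps has room for `K + 1` points spaced twice the radius `2 ^ K` apart, which makes it spacious.
threshold : Sentence → ℕ
threshold φ = let K = 3 + rank φ in K * (2 ^ K + 2 ^ K)

lasso-⊨ : ∀ φ → 𝒜 ⊨ φ → ∀ m k → threshold φ ≤ m → threshold φ ≤ k → algebra (Lasso.advance m k) ⊨ φ
lasso-⊨ φ 𝒜⊨φ m k T≤m T≤k =
  transfer {G = 𝒜-glued} {H = Lasso.lasso m k} 𝒜-spacious
    (Lasso.lasso-spacious m k (≤-trans T≤m (m≤m+n m k))) φ ≤-refl
    (opening m k ≤-refl (≤-trans 2ʲ≤T T≤m) (≤-trans 2ʲ≤T T≤k)) (λ ()) 𝒜⊨φ
  where
  j = rank φ
  2ʲ≤T : 2 ^ j ≤ threshold φ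
  2ʲ≤T = ≤-trans (^-monoʳ-≤ 2 (m≤n+m j 3)) (≤-trans (m≤m+n (2 ^ (3 + j)) (2 ^ (3 + j))) (m≤m+n _ _))

Presented-⊨-large : ∀ φ → 𝒜 ⊨ φ → ∀ m k → threshold φ ≤ m → threshold φ ≤ k →
  (Presented (m , suc (m + k)) ⊨ φ) × (Presented (suc (m + k) , m) ⊨ φ)
Presented-⊨-large φ 𝒜⊨φ m k T≤m T≤k =
  from (Lasso.Presented-lasso m k φ) lasso⊨φ , from (Lasso.Presented-lassoᵒ m k φ) lasso⊨φ
  where lasso⊨φ = lasso-⊨ φ 𝒜⊨φ m k T≤m T≤k

-- Counting identities

lookup-injective : {xs : List A} → Unique xs → ∀ {i j} → lookup xs i ≡ lookup xs j → i ≡ j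
lookup-injective {xs = x ∷ xs} (x∉xs ∷ u) {zero}  {zero}  _  = refl
lookup-injective {xs = x ∷ xs} (x∉xs ∷ u) {zero}  {suc j} eq = contradiction eq (All.lookup x∉xs (∈-lookup j))
lookup-injective {xs = x ∷ xs} (x∉xs ∷ u) {suc i} {zero}  eq = contradiction (sym eq) (All.lookup x∉xs (∈-lookup i))
lookup-injective {xs = x ∷ xs} (x∉xs ∷ u) {suc i} {suc j} eq = cong suc (lookup-injective u eq)

-- Each position of `xs` is sent to a position of `ys` holding the same element; as `xs` has no
-- repetitions, this is injective.
unique-⊆⇒length≤ : {xs ys : List A} → Unique xs → xs ⊆ ys → length xs ≤ length ys
unique-⊆⇒length≤ {xs = xs} {ys} u xs⊆ys = injective⇒≤ {f = λ i → Any.index (xs⊆ys (∈-lookup i))}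
  λ {i} {j} same → lookup-injective u
    (trans (lookup-index (xs⊆ys (∈-lookup i)))
      (trans (cong (lookup ys) same) (sym (lookup-index (xs⊆ys (∈-lookup j))))))

length-cartesianProduct : (xs : List A) (ys : List B) →
  length (cartesianProduct xs ys) ≡ length xs * length ys
length-cartesianProduct []       ys = refl
length-cartesianProduct (x ∷ xs) ys =
  trans (length-++ (List.map (x ,_) ys))
    (cong₂ _+_ (length-map (x ,_) ys) (length-cartesianProduct xs ys))

rectangle : ℕ → ℕ → List (ℕ × ℕ)
rectangle m n = cartesianProduct (upTo m) (upTo n)

length-rectangle : ∀ m n → length (rectangle m n) ≡ m * n
length-rectangle m n =
  trans (length-cartesianProduct (upTo m) (upTo n)) (cong₂ _*_ (length-upTo m) (length-upTo n))

∈-rectangle : ∀ {m n i j} → i < m → j < n → (i , j) ∈ rectangle m n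
∈-rectangle i<m j<n = ∈-cartesianProduct⁺ (∈-upTo⁺ i<m) (∈-upTo⁺ j<n)

identities-unique : ∀ s → Unique (identities s)
identities-unique s = filter⁺ (λ p → len p ≤? s) (cartesianProduct⁺ (upTo⁺ (suc s)) (upTo⁺ (suc s)))

∈-identities⁺ : ∀ {r r′ s} → r + r′ ≤ s → (r , r′) ∈ identities s
∈-identities⁺ {r} {r′} {s} r+r′≤s = ∈-filter⁺ (λ p → len p ≤? s)
  (∈-rectangle (s≤s (≤-trans (m≤m+n r r′) r+r′≤s)) (s≤s (≤-trans (m≤n+m r′ r) r+r′≤s))) r+r′≤s

∈-identities⁻ : ∀ {r r′ s} → (r , r′) ∈ identities s → r + r′ ≤ s
∈-identities⁻ {s = s} p∈ = proj₂ (∈-filter⁻ (λ p → len p ≤? s) {xs = rectangle (suc s) (suc s)} p∈)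

-- Shows that the count grows quadratically: two exponents up to `h` have sum at most `h + h`.
square≤P : ∀ h {s} → h + h ≤ s → suc h * suc h ≤ P s
square≤P h {s} 2h≤s = subst (_≤ P s) (length-rectangle (suc h) (suc h))
  (unique-⊆⇒length≤ (cartesianProduct⁺ (upTo⁺ (suc h)) (upTo⁺ (suc h))) square⊆)
  where
  square⊆ : rectangle (suc h) (suc h) ⊆ identities s
  square⊆ p∈ with r∈ , r′∈ ← ∈-cartesianProduct⁻ (upTo (suc h)) (upTo (suc h)) p∈ =
    ∈-identities⁺ (≤-trans (+-mono-≤ (s≤s⁻¹ (∈-upTo⁻ r∈)) (s≤s⁻¹ (∈-upTo⁻ r′∈))) 2h≤s)

-- Covers the identities whose lasso has a tail shorter than T or a cycle of
-- length at most T, and those with r = r′.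
exceptional : ℕ → ℕ → List Identity
exceptional T s =
  rectangle T (suc s) ++ rectangle (suc s) T ++
  List.map (λ (r , i) → r , r + i) (rectangle (suc s) (suc T)) ++
  List.map (λ (r , i) → r + i , r) (rectangle (suc s) (suc T))

-- Each of the four lists has at most `suc T * suc s` entries.
length-exceptional : ∀ T s → length (exceptional T s) ≤ 4 * suc T * suc s
length-exceptional T s = begin
  length (exceptional T s)
    ≡⟨ length-++ (rectangle T (suc s)) ⟩
  length (rectangle T (suc s)) + _
    ≡⟨ cong₂ _+_ (length-rectangle T (suc s)) (length-++ (rectangle (suc s) T)) ⟩
  T * suc s + (length (rectangle (suc s) T) + _)
    ≡⟨ cong (λ x → T * suc s + x) (cong₂ _+_ (length-rectangle (suc s) T)
         (trans (length-++ (List.map _ (rectangle (suc s) (suc T))))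
           (cong₂ _+_ (trans (length-map _ (rectangle (suc s) (suc T))) (length-rectangle (suc s) (suc T)))
                      (trans (length-map _ (rectangle (suc s) (suc T))) (length-rectangle (suc s) (suc T)))))) ⟩
  T * suc s + (suc s * T + (suc s * suc T + suc s * suc T))
    ≤⟨ +-mono-≤ (*-monoˡ-≤ (suc s) (n≤1+n T)) (+-monoˡ-≤ _ (*-monoʳ-≤ (suc s) (n≤1+n T))) ⟩
  suc T * suc s + (suc s * suc T + (suc s * suc T + suc s * suc T))
    ≡⟨ solve 2 (λ t s → t :* s :+ (s :* t :+ (s :* t :+ s :* t)) := con 4 :* t :* s) refl (suc T) (suc s) ⟩
  4 * suc T * suc s ∎
  where
  open ≤-Reasoning
  open +-*-Solver

-- The distance is `(n ∸ g) / n`, hence at most `δ / n`, which is below 1/d for d the denominator of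
-- `ε`; a positive `ε` has numerator at least 1.
∣g/n-1∣<ε : ∀ g n .{{_ : NonZero n}} ε → 0ℚ ℚ.< ε → g ≤ n → ∀ {δ} → n ≤ g + δ → δ * ℚ.↧ₙ ε < n →
  ℚ.∣ (+ g) ℚ./ n ℚ.- 1ℚ ∣ ℚ.< ε
∣g/n-1∣<ε g (suc n) (mkℚ (+ zero) _ _)  (ℚ.*<* (ℤ.+<+ ()))
∣g/n-1∣<ε g (suc n) (mkℚ -[1+ _ ] _ _)  (ℚ.*<* ())
∣g/n-1∣<ε g (suc n) (mkℚ (+ suc a) d-1 _) 0<ε g≤n {δ} n≤g+δ δd<n =
  ℚ.toℚᵘ-cancel-< (ℚᵘ.<-respˡ-≃ (ℚᵘ.≃-sym unnormalised) (*<* (subst₂ ℤ._<_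
    (ℤ.pos-* ℤ.∣ numerator ∣ (suc d-1)) (ℤ.pos-* (suc a) (suc n * 1)) (ℤ.+<+ bound))))
  where
  -- The shape that subtraction of unnormalised rationals computes to, over the denominator
  -- `suc n * 1`.
  numerator : ℤ
  numerator = + g ℤ.* + 1 ℤ.+ ℤ.-1ℤ ℤ.* + suc n

  unnormalised : toℚᵘ (ℚ.∣ (+ g) ℚ./ suc n ℚ.- 1ℚ ∣) ℚᵘ.≃ ℚᵘ.∣ mkℚᵘ (+ g) n ℚᵘ.- ℚᵘ.1ℚᵘ ∣
  unnormalised = ℚᵘ.≃-trans (ℚ.toℚᵘ-homo-∣-∣ ((+ g) ℚ./ suc n ℚ.- 1ℚ))
    (ℚᵘ.∣-∣-cong (ℚᵘ.≃-trans (ℚ.toℚᵘ-homo-+ ((+ g) ℚ./ suc n) (ℚ.- 1ℚ))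
      (ℚᵘ.+-congˡ (ℚᵘ.- ℚᵘ.1ℚᵘ) (ℚ.toℚᵘ-fromℚᵘ (mkℚᵘ (+ g) n)))))

  ∣numerator∣ : ℤ.∣ numerator ∣ ≡ suc n ∸ g
  ∣numerator∣ = trans
    (cong ℤ.∣_∣ (trans (cong₂ ℤ._+_ (ℤ.*-identityʳ (+ g)) (ℤ.-1*i≡-i (+ suc n))) (ℤ.m-n≡m⊖n g (suc n))))
    (ℤ.∣⊖∣-≤ g≤n)

  bound : ℤ.∣ numerator ∣ * suc d-1 < suc a * (suc n * 1)
  bound = begin-strict
    ℤ.∣ numerator ∣ * suc d-1 ≡⟨ cong (_* suc d-1) ∣numerator∣ ⟩
    (suc n ∸ g) * suc d-1     ≤⟨ *-monoˡ-≤ (suc d-1) (m≤n+o⇒m∸n≤o (suc n) g n≤g+δ) ⟩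
    δ * suc d-1               <⟨ δd<n ⟩
    suc n                     ≤⟨ m≤n*m (suc n) (suc a) ⟩
    suc a * suc n             ≡⟨ cong (suc a *_) (*-identityʳ (suc n)) ⟨
    suc a * (suc n * 1)       ∎
    where open ≤-Reasoning

-- With `h` half of `s` rounded down, `suc s ≤ suc h + suc h` bounds the left side by
-- `8 * suc T * D * suc h`, and `8 * suc T * D ≤ h` puts this below the square `suc h * suc h`.
4[1+T][1+s]D<P : ∀ T D s → 16 * suc T * D ≤ s → 4 * suc T * suc s * D < P s
4[1+T][1+s]D<P T D s N≤s = begin-strict
  4 * suc T * suc s * D           ≤⟨ *-monoˡ-≤ D (*-monoʳ-≤ (4 * suc T) s<2h+2) ⟩
  4 * suc T * (suc h + suc h) * D ≡⟨ solve 3 (λ t h d → con 4 :* t :* (h :+ h) :* d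
                                                     := con 8 :* t :* d :* h) refl (suc T) (suc h) D ⟩
  8 * suc T * D * suc h           <⟨ *-monoˡ-< (suc h) (s≤s 8TD≤h) ⟩
  suc h * suc h                   ≤⟨ square≤P h 2h≤s ⟩
  P s                             ∎
  where
  open ≤-Reasoning
  open +-*-Solver
  h = ⌊ s /2⌋
  2h≤s : h + h ≤ s
  2h≤s = ≤-trans (+-monoʳ-≤ h (⌊n/2⌋≤⌈n/2⌉ s)) (≤-reflexive (⌊n/2⌋+⌈n/2⌉≡n s))
  s<2h+2 : suc s ≤ suc h + suc h
  s<2h+2 = s≤s (≤-trans (≤-reflexive (sym (⌊n/2⌋+⌈n/2⌉≡n s))) (+-monoʳ-≤ h (⌊n/2⌋-mono (n≤1+n (suc s)))))
  8TD≤h : 8 * suc T * D ≤ h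
  8TD≤h = ≤-trans (≤-reflexive (n≡⌊n+n/2⌋ (8 * suc T * D)))
    (⌊n/2⌋-mono (≤-trans (≤-reflexive
      (solve 2 (λ t d → con 8 :* t :* d :+ con 8 :* t :* d := con 16 :* t :* d) refl (suc T) D)) N≤s))

module _ {Q : Identity → Set₁} (Q? : Decidable Q) (T : ℕ)
  (large : ∀ m k → T ≤ m → T ≤ k → Q (m , suc (m + k)) × Q (suc (m + k) , m)) where

  unsatisfied⇒exceptional : ∀ s p → len p ≤ s → ¬ Q p → p ∈ exceptional T s
  unsatisfied⇒exceptional s (r , r′) r+r′≤s ¬Q with compare r r′
  -- Equal exponents are filed under difference 0; the differences `k + 1` with `k < T` run from 1
  -- to `T`.
  ... | equal r = ∈-++⁺ʳ (rectangle T (suc s)) (∈-++⁺ʳ (rectangle (suc s) T) (∈-++⁺ˡ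
          (subst (λ x → (r , x) ∈ List.map (λ (r , i) → r , r + i) (rectangle (suc s) (suc T))) (+-identityʳ r)
            (∈-map⁺ (λ (r , i) → r , r + i) (∈-rectangle (s≤s (≤-trans (m≤m+n r r) r+r′≤s)) z<s)))))
  ... | less m k with T ≤? m | T ≤? k
  ...   | no T≰m  | _ = ∈-++⁺ˡ (∈-rectangle (≰⇒> T≰m) (s≤s (≤-trans (m≤n+m (suc (m + k)) m) r+r′≤s)))
  ...   | yes T≤m | yes T≤k = contradiction (proj₁ (large m k T≤m T≤k)) ¬Q
  ...   | yes _   | no T≰k = ∈-++⁺ʳ (rectangle T (suc s)) (∈-++⁺ʳ (rectangle (suc s) T) (∈-++⁺ˡ
          (subst (λ x → (m , x) ∈ List.map (λ (r , i) → r , r + i) (rectangle (suc s) (suc T))) (+-suc m k)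
            (∈-map⁺ (λ (r , i) → r , r + i)
              (∈-rectangle (s≤s (≤-trans (m≤m+n m (suc (m + k))) r+r′≤s)) (s≤s (≰⇒> T≰k)))))))
  unsatisfied⇒exceptional s (r , r′) r+r′≤s ¬Q | greater m k with T ≤? m | T ≤? k
  ...   | no T≰m  | _ = ∈-++⁺ʳ (rectangle T (suc s)) (∈-++⁺ˡ
          (∈-rectangle (s≤s (≤-trans (m≤m+n (suc (m + k)) m) r+r′≤s)) (≰⇒> T≰m)))
  ...   | yes T≤m | yes T≤k = contradiction (proj₂ (large m k T≤m T≤k)) ¬Q
  ...   | yes _   | no T≰k = ∈-++⁺ʳ (rectangle T (suc s)) (∈-++⁺ʳ (rectangle (suc s) T)
          (∈-++⁺ʳ (List.map _ (rectangle (suc s) (suc T)))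
          (subst (λ x → (x , m) ∈ List.map (λ (r , i) → r + i , r) (rectangle (suc s) (suc T))) (+-suc m k)
            (∈-map⁺ (λ (r , i) → r + i , r)
              (∈-rectangle (s≤s (≤-trans (m≤n+m m (suc (m + k))) r+r′≤s)) (s≤s (≰⇒> T≰k)))))))

  P≤P[Q]+exceptional : ∀ s → P s ≤ P[ Q? ] s + 4 * suc T * suc s
  P≤P[Q]+exceptional s = begin
    P s                                                     ≤⟨ unique-⊆⇒length≤ (identities-unique s) split ⟩
    length (filter Q? (identities s) ++ exceptional T s)    ≡⟨ length-++ (filter Q? (identities s)) ⟩
    P[ Q? ] s + length (exceptional T s)                    ≤⟨ +-monoʳ-≤ (P[ Q? ] s) (length-exceptional T s) ⟩
    P[ Q? ] s + 4 * suc T * suc s                           ∎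
    where
    open ≤-Reasoning
    split : identities s ⊆ filter Q? (identities s) ++ exceptional T s
    split {p} p∈ with Q? p
    ... | yes Qp = ∈-++⁺ˡ (∈-filter⁺ Q? p∈ Qp)
    ... | no ¬Qp = ∈-++⁺ʳ (filter Q? (identities s)) (unsatisfied⇒exceptional s p (∈-identities⁻ p∈) ¬Qp)

  density-1 : Converges (λ s → (+ P[ Q? ] s) ℚ./ P s) 1ℚ
  -- From this bound on, the linear number of exceptions times the denominator of `ε` stays below
  -- `P s`.
  density-1 ε 0<ε = 16 * suc T * ℚ.↧ₙ ε , λ s N≤s →
    ∣g/n-1∣<ε (P[ Q? ] s) (P s) ε 0<ε (length-filter Q? (identities s))
      (P≤P[Q]+exceptional s) (4[1+T][1+s]D<P T (ℚ.↧ₙ ε) s N≤s)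

proposition3p15 : (φ : Sentence) → 𝒜 ⊨ φ → HasLimitingDensity φ 1ℚ
proposition3p15 φ 𝒜⊨φ =
  Presented? φ , density-1 (Presented? φ) (threshold φ) (Presented-⊨-large φ 𝒜⊨φ)
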